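{- Let $p \geq 5$ be a prime and let $n \geq 0$ be an integer. If the base-$p$ digits of $n$ all belong to $\{0, p - 1\}$, then $A(n) \equiv 1 \pmod{p^3}$.
   Context: For non-negative integers $n$, $A(n)=\sum_{k\ge0}\binom{n}{k}^2\binom{n+k}{k}^2$ is the $n$th Ap\'ery number. -}

module Defs where

open import Data.Nat using (ℕ; zero; suc; _+_; _*_; _∸_; _^_; NonZero)
open import Data.Nat.Combinatorics using (_C_)
open import Data.Nat.DivMod using (_/_; _%_)
open import Data.Sum using (_⊎_)
open import Relation.Binary.PropositionalEquality using (_≡_)

sumTo : ℕ → (ℕ → ℕ) → ℕ
sumTo zero    f = f 0
sumTo (suc m) f = sumTo m f + f (suc m)

-- Apéry number A(n) = Σ_{k≥0} C(n,k)^2 C(n+k,k)^2 ; terms with k > n vanish.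
apery : ℕ → ℕ
apery n = sumTo n (λ k → ((n C k) * (n C k)) * (((n + k) C k) * ((n + k) C k)))

digit : (p : ℕ) .{{_ : NonZero p}} → ℕ → ℕ → ℕ
digit p n zero    = n % p
digit p n (suc i) = digit p (n / p) i

{-# OPTIONS --safe #-}

-- For x ∈ ℤ let t_x(k) = ∏_{i<k} (x − i)(x + i + 1)/(i + 1)². Then t_n(k) = C(n,k) C(n+k,k),
-- and t_x = t_{−1−x}, so that for n = (m+1)p − 1 the same sequence is t_x with x = −(m+1)p.
-- Hence A(mp) ≡ A(m) and A((m+1)p − 1) ≡ A(m) modulo p³ are two instances (N = m and
-- N = −(m+1)) of one comparison between Σ t_{pN}(k)² and Σ t_N(j)².
-- Terms with k = jp: the block products W(a) = ∏_{0<r<p} (pa + r) satisfy W(a) ≡ W(0) modulo p³,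
-- since pairing r with p − r gives factors r(p − r) + p²a(a+1), and so t_{pN}(jp) ≡ t_N(j).
-- Terms with k = jp + r, 0 < r < p: here p ∣ t_{pN}(k) and r² t_{pN}(k)² does not depend
-- on r modulo p³. Both parts rest on s := Σ_{r ≤ (p−1)/2} 1/r² ≡ 0 modulo p: by r ↦ p − r the
-- sum of 1/r² over 0 < r < p is both 2s and twice the sum s/4 over even r, so 3s ≡ 0.
module Submission where

open import Algebra.Core using (Op₂)
open import Algebra.Structures using (IsCommutativeMonoid)
open import Data.Integer.Base using (ℤ; +_; -[1+_]; 0ℤ; 1ℤ; -1ℤ; _+_; _-_; _*_; -_)
open import Data.Integer.Properties as ℤ
  using (pos-*; +-0-isCommutativeMonoid; *-1-isCommutativeMonoid)
open import Data.Integer.Tactic.RingSolver using (solve-∀)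
open import Data.Nat as ℕ
  using (ℕ; zero; suc; _∸_; _^_; _<_; _≥_; z≤n; s≤s; z<s; NonZero)
open import Data.Nat.Combinatorics using (_C_; nCk+nC[k+1]≡[n+1]C[k+1]; nC1≡n; k>n⇒nCk≡0)
open import Data.Nat.Coprimality using (prime⇒coprime; coprime-Bézout)
open import Data.Nat.DivMod using (_%_; _/_; m≡m%n+[m/n]*n; m/n<m; [m+kn]%n≡m%n)
open import Data.Nat.Divisibility using (divides)
open import Data.Nat.GCD using (module Bézout)
open import Data.Nat.Induction using (<-rec)
open import Data.Nat.Primality using (Prime; prime⇒irreducible)
open import Data.Nat.Properties as ℕ using (m^n≢0)
open import Data.Nat.Tactic.RingSolver renaming (solve-∀ to solveℕ-∀)
open import Data.Product using (∃; _,_; proj₁; proj₂; _×_)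
open import Data.Sum using (_⊎_; inj₁; inj₂)
open import Defs
open import Level using (0ℓ)
open import Relation.Binary.Bundles using (Setoid)
open import Relation.Binary.PropositionalEquality
  using (_≡_; refl; sym; trans; cong; cong₂; subst; module ≡-Reasoning)
import Relation.Binary.Reasoning.Setoid as SetoidReasoning
open import Relation.Nullary using (yes; no; contradiction)

-- Finite sums and products

module Fold {A : Set} {_∙_ : Op₂ A} {ε : A} (isCM : IsCommutativeMonoid _≡_ _∙_ ε) where
  open IsCommutativeMonoid isCM using (assoc; comm; identityˡ; identityʳ)
  open ≡-Reasoning

  fold : (ℕ → A) → ℕ → A
  fold f zero    = ε
  fold f (suc n) = fold f n ∙ f n

  -- Stated for any relation compatible with `_∙_`, so that equalities and congruences, of sums and
  -- of products, are all instances.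
  fold-lift : (R : A → A → Set) → R ε ε →
              (∀ {a b c d} → R a b → R c d → R (a ∙ c) (b ∙ d)) →
              ∀ {f g} n → (∀ i → i < n → R (f i) (g i)) → R (fold f n) (fold g n)
  fold-lift R Rε R∙ zero    fRg = Rε
  fold-lift R Rε R∙ (suc n) fRg =
    R∙ (fold-lift R Rε R∙ n (λ i i<n → fRg i (ℕ.m<n⇒m<1+n i<n))) (fRg n ℕ.≤-refl)

  fold-cong : ∀ {f g} n → (∀ i → i < n → f i ≡ g i) → fold f n ≡ fold g n
  fold-cong = fold-lift _≡_ refl (cong₂ _∙_)

  fold-++ : ∀ f m n → fold f (m ℕ.+ n) ≡ fold f m ∙ fold (λ i → f (m ℕ.+ i)) n
  fold-++ f m zero    = trans (cong (fold f) (ℕ.+-identityʳ m)) (sym (identityʳ _))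
  fold-++ f m (suc n) = begin
    fold f (m ℕ.+ suc n)                  ≡⟨ cong (fold f) (ℕ.+-suc m n) ⟩
    fold f (m ℕ.+ n) ∙ f (m ℕ.+ n)        ≡⟨ cong (_∙ f (m ℕ.+ n)) (fold-++ f m n) ⟩
    (fold f m ∙ fold (λ i → f (m ℕ.+ i)) n) ∙ f (m ℕ.+ n) ≡⟨ assoc _ _ _ ⟩
    fold f m ∙ fold (λ i → f (m ℕ.+ i)) (suc n) ∎

  fold-first : ∀ f n → fold f (suc n) ≡ f 0 ∙ fold (λ i → f (suc i)) n
  fold-first f n = trans (fold-++ f 1 n) (cong (_∙ fold (λ i → f (suc i)) n) (identityˡ (f 0)))

  interchange : ∀ a b c d → (a ∙ b) ∙ (c ∙ d) ≡ (a ∙ c) ∙ (b ∙ d)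
  interchange a b c d = begin
    (a ∙ b) ∙ (c ∙ d) ≡⟨ assoc a b _ ⟩
    a ∙ (b ∙ (c ∙ d)) ≡⟨ cong (a ∙_) (assoc b c d) ⟨
    a ∙ ((b ∙ c) ∙ d) ≡⟨ cong (λ y → a ∙ (y ∙ d)) (comm b c) ⟩
    a ∙ ((c ∙ b) ∙ d) ≡⟨ cong (a ∙_) (assoc c b d) ⟩
    a ∙ (c ∙ (b ∙ d)) ≡⟨ assoc a c _ ⟨
    (a ∙ c) ∙ (b ∙ d) ∎

  fold-∙ : ∀ f g n → fold (λ i → f i ∙ g i) n ≡ fold f n ∙ fold g n
  fold-∙ f g zero    = sym (identityʳ ε)
  fold-∙ f g (suc n) = begin
    fold (λ i → f i ∙ g i) n ∙ (f n ∙ g n) ≡⟨ cong (_∙ (f n ∙ g n)) (fold-∙ f g n) ⟩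
    (fold f n ∙ fold g n) ∙ (f n ∙ g n)    ≡⟨ interchange _ _ _ _ ⟩
    (fold f n ∙ f n) ∙ (fold g n ∙ g n)    ∎

  fold-reverse : ∀ f n → fold f n ≡ fold (λ i → f (n ∸ suc i)) n
  fold-reverse f zero    = refl
  fold-reverse f (suc n) = begin
    fold f n ∙ f n                        ≡⟨ comm _ _ ⟩
    f n ∙ fold f n                        ≡⟨ cong (f n ∙_) (fold-reverse f n) ⟩
    f n ∙ fold (λ i → f (n ∸ suc i)) n    ≡⟨ fold-first (λ i → f (n ∸ i)) n ⟨
    fold (λ i → f (n ∸ i)) (suc n)        ∎

  fold-parity : ∀ f n →
    fold f (n ℕ.+ n) ≡ fold (λ i → f (i ℕ.+ i)) n ∙ fold (λ i → f (suc (i ℕ.+ i))) n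
  fold-parity f zero    = sym (identityʳ ε)
  fold-parity f (suc n) = begin
    fold f (suc n ℕ.+ suc n)                               ≡⟨ cong (λ k → fold f (suc k)) (ℕ.+-suc n n) ⟩
    (fold f (n ℕ.+ n) ∙ f (n ℕ.+ n)) ∙ f (suc (n ℕ.+ n))   ≡⟨ assoc _ _ _ ⟩
    fold f (n ℕ.+ n) ∙ (f (n ℕ.+ n) ∙ f (suc (n ℕ.+ n)))   ≡⟨ cong (_∙ (f (n ℕ.+ n) ∙ f (suc (n ℕ.+ n)))) (fold-parity f n) ⟩
    (fold (λ i → f (i ℕ.+ i)) n ∙ fold (λ i → f (suc (i ℕ.+ i))) n)
      ∙ (f (n ℕ.+ n) ∙ f (suc (n ℕ.+ n)))                  ≡⟨ interchange _ _ _ _ ⟩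
    _ ∎

open Fold +-0-isCommutativeMonoid using () renaming
  ( fold to ∑; fold-lift to ∑-lift; fold-cong to ∑-cong; fold-++ to ∑-++; fold-first to ∑-first
  ; fold-reverse to ∑-reverse; fold-parity to ∑-parity)
open Fold *-1-isCommutativeMonoid using () renaming
  ( fold to ∏; fold-lift to ∏-lift; fold-cong to ∏-cong; fold-++ to ∏-++
  ; fold-first to ∏-first; fold-∙ to ∏-*; fold-reverse to ∏-reverse)

*-distribˡ-∑ : ∀ c f n → c * ∑ f n ≡ ∑ (λ i → c * f i) n
*-distribˡ-∑ c f zero    = ℤ.*-zeroʳ c
*-distribˡ-∑ c f (suc n) =
  trans (ℤ.*-distribˡ-+ c (∑ f n) (f n)) (cong (_+ c * f n) (*-distribˡ-∑ c f n))

-- Congruences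

infix 4 _≡_[mod_]

-- The quotient is kept as data: congruences compose by explicit quotients, and `p-part` later reads
-- a cofactor of `P` off a congruence to 0.
record _≡_[mod_] (x y m : ℤ) : Set where
  constructor mod
  field
    quotient : ℤ
    equality : x ≡ y + quotient * m

module _ {m : ℤ} where

  ≡⇒mod : ∀ {x y} → x ≡ y → x ≡ y [mod m ]
  ≡⇒mod {x} refl = mod 0ℤ (lemma x m)
    where
    lemma : ∀ x m → x ≡ x + 0ℤ * m
    lemma = solve-∀

  mod-refl : ∀ {x} → x ≡ x [mod m ]
  mod-refl = ≡⇒mod refl

  mod-sym : ∀ {x y} → x ≡ y [mod m ] → y ≡ x [mod m ]
  mod-sym {y = y} (mod a refl) = mod (- a) (lemma y a m)
    where
    lemma : ∀ y a m → y ≡ y + a * m + - a * m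
    lemma = solve-∀

  mod-trans : ∀ {x y z} → x ≡ y [mod m ] → y ≡ z [mod m ] → x ≡ z [mod m ]
  mod-trans {z = z} (mod a refl) (mod b refl) = mod (a + b) (lemma z a b m)
    where
    lemma : ∀ z a b m → z + b * m + a * m ≡ z + (a + b) * m
    lemma = solve-∀

  mod-+ : ∀ {x y u v} → x ≡ y [mod m ] → u ≡ v [mod m ] → x + u ≡ y + v [mod m ]
  mod-+ {y = y} {v = v} (mod a refl) (mod b refl) = mod (a + b) (lemma y v a b m)
    where
    lemma : ∀ y v a b m → (y + a * m) + (v + b * m) ≡ y + v + (a + b) * m
    lemma = solve-∀

  mod-* : ∀ {x y u v} → x ≡ y [mod m ] → u ≡ v [mod m ] → x * u ≡ y * v [mod m ]
  mod-* {y = y} {v = v} (mod a refl) (mod b refl) = mod (a * v + y * b + a * b * m) (lemma y v a b m)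
    where
    lemma : ∀ y v a b m → (y + a * m) * (v + b * m) ≡ y * v + (a * v + y * b + a * b * m) * m
    lemma = solve-∀

  mod-*ˡ : ∀ c {x y} → x ≡ y [mod m ] → c * x ≡ c * y [mod m ]
  mod-*ˡ c = mod-* (mod-refl {c})

  mod-*ʳ : ∀ c {x y} → x ≡ y [mod m ] → x * c ≡ y * c [mod m ]
  mod-*ʳ c x≡y = mod-* x≡y (mod-refl {c})

modSetoid : ℤ → Setoid 0ℓ 0ℓ
modSetoid m = record
  { Carrier       = ℤ
  ; _≈_           = λ x y → x ≡ y [mod m ]
  ; isEquivalence = record { refl = mod-refl ; sym = mod-sym ; trans = mod-trans }
  }

module ModReasoning (m : ℤ) = SetoidReasoning (modSetoid m)

∑-mod : ∀ {m f g} n → (∀ i → i < n → f i ≡ g i [mod m ]) → ∑ f n ≡ ∑ g n [mod m ]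
∑-mod {m} = ∑-lift (λ x y → x ≡ y [mod m ]) mod-refl mod-+

∏-mod : ∀ {m f g} n → (∀ i → i < n → f i ≡ g i [mod m ]) → ∏ f n ≡ ∏ g n [mod m ]
∏-mod {m} = ∏-lift (λ x y → x ≡ y [mod m ]) mod-refl mod-*

cube : ℤ → ℤ
cube p = p * (p * p)

mod-cube⇒mod : ∀ p {x y} → x ≡ y [mod cube p ] → x ≡ y [mod p ]
mod-cube⇒mod p {y = y} (mod a refl) = mod (a * (p * p)) (lemma y a p)
  where
  lemma : ∀ y a p → y + a * (p * (p * p)) ≡ y + a * (p * p) * p
  lemma = solve-∀

mod-scale : ∀ p d {x y} → x ≡ y [mod p ] → (p * p) * d * x ≡ (p * p) * d * y [mod cube p ]
mod-scale p d {y = y} (mod a refl) = mod (d * a) (lemma y a p d)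
  where
  lemma : ∀ y a p d → (p * p) * d * (y + a * p) ≡ (p * p) * d * y + (d * a) * (p * (p * p))
  lemma = solve-∀

-- Units modulo m

record Invertible (m a : ℤ) : Set where
  constructor unit
  field
    reciprocal : ℤ
    isInverse  : a * reciprocal ≡ 1ℤ [mod m ]

-- Evaluate x b y in two ways. Chosen reciprocals have no canonical form, so identities between them
-- are derived from their defining property.
inverse-unique : ∀ {m a b x y} → a * x ≡ 1ℤ [mod m ] → b * y ≡ 1ℤ [mod m ] →
                 a ≡ b [mod m ] → x ≡ y [mod m ]
inverse-unique {m} {a} {b} {x} {y} ax≡1 by≡1 a≡b = begin
  x           ≡⟨ ℤ.*-identityʳ x ⟨
  x * 1ℤ      ≈⟨ mod-*ˡ x by≡1 ⟨
  x * (b * y) ≈⟨ mod-*ˡ x (mod-*ʳ y a≡b) ⟨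
  x * (a * y) ≡⟨ lemma x a y ⟩
  a * x * y   ≈⟨ mod-*ʳ y ax≡1 ⟩
  1ℤ * y      ≡⟨ ℤ.*-identityˡ y ⟩
  y           ∎
  where
  open ModReasoning m
  lemma : ∀ x a y → x * (a * y) ≡ a * x * y
  lemma = solve-∀

*-cancelˡ-mod : ∀ {m a x y} → Invertible m a → a * x ≡ a * y [mod m ] → x ≡ y [mod m ]
*-cancelˡ-mod {m} {a} {x} {y} (unit b ab≡1) ax≡ay = begin
  x           ≡⟨ ℤ.*-identityˡ x ⟨
  1ℤ * x      ≈⟨ mod-*ʳ x ab≡1 ⟨
  a * b * x   ≡⟨ lemma a b x ⟩
  b * (a * x) ≈⟨ mod-*ˡ b ax≡ay ⟩
  b * (a * y) ≡⟨ lemma a b y ⟨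
  a * b * y   ≈⟨ mod-*ʳ y ab≡1 ⟩
  1ℤ * y      ≡⟨ ℤ.*-identityˡ y ⟩
  y           ∎
  where
  open ModReasoning m
  lemma : ∀ a b x → a * b * x ≡ b * (a * x)
  lemma = solve-∀

Invertible-* : ∀ {m a b} → Invertible m a → Invertible m b → Invertible m (a * b)
Invertible-* {m} {a} {b} (unit c ac≡1) (unit d bd≡1) =
  unit (c * d) (mod-trans (≡⇒mod (lemma a b c d)) (mod-* {x = a * c} ac≡1 bd≡1))
  where
  lemma : ∀ a b c d → a * b * (c * d) ≡ a * c * (b * d)
  lemma = solve-∀

Invertible-resp : ∀ {m a b} → a ≡ b [mod m ] → Invertible m a → Invertible m b
Invertible-resp a≡b (unit c ac≡1) = unit c (mod-trans (mod-*ʳ c (mod-sym a≡b)) ac≡1)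

Invertible-∏ : ∀ {m f} n → (∀ i → i < n → Invertible m (f i)) → Invertible m (∏ f n)
Invertible-∏ zero    inv = unit 1ℤ mod-refl
Invertible-∏ {f = f} (suc n) inv = Invertible-*
  (Invertible-∏ n (λ i i<n → inv i (ℕ.m<n⇒m<1+n i<n))) (inv n ℕ.≤-refl)

-- If a b = 1 + z p, then (1 + z p)(1 − z p + z² p²) = 1 + z³ p³.
Invertible-cube : ∀ {p a} → Invertible p a → Invertible (cube p) a
Invertible-cube {p} {a} (unit b (mod z ab≡1+zp)) =
  unit (b * (1ℤ - z * p + z * p * (z * p))) (mod (z * (z * z)) (begin
    a * (b * (1ℤ - z * p + z * p * (z * p)))             ≡⟨ ℤ.*-assoc a b _ ⟨
    a * b * (1ℤ - z * p + z * p * (z * p))               ≡⟨ cong (_* (1ℤ - z * p + z * p * (z * p))) ab≡1+zp ⟩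
    (1ℤ + z * p) * (1ℤ - z * p + z * p * (z * p))        ≡⟨ lemma z p ⟩
    1ℤ + z * (z * z) * cube p                            ∎))
  where
  open ≡-Reasoning
  lemma : ∀ z p → (1ℤ + z * p) * (1ℤ - z * p + z * p * (z * p)) ≡ 1ℤ + z * (z * z) * (p * (p * p))
  lemma = solve-∀

-- The signs cancel in pairs; the intended length is p - 1 = 2h.
∏-neg : ∀ f n → ∏ (λ i → - f i) (n ℕ.+ n) ≡ ∏ f (n ℕ.+ n)
∏-neg f zero    = refl
∏-neg f (suc n) rewrite ℕ.+-suc n n = begin
  ∏ (λ i → - f i) (n ℕ.+ n) * - f (n ℕ.+ n) * - f (suc (n ℕ.+ n))
    ≡⟨ cong (λ z → z * - f (n ℕ.+ n) * - f (suc (n ℕ.+ n))) (∏-neg f n) ⟩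
  ∏ f (n ℕ.+ n) * - f (n ℕ.+ n) * - f (suc (n ℕ.+ n))
    ≡⟨ lemma (∏ f (n ℕ.+ n)) (f (n ℕ.+ n)) (f (suc (n ℕ.+ n))) ⟩
  ∏ f (n ℕ.+ n) * f (n ℕ.+ n) * f (suc (n ℕ.+ n)) ∎
  where
  open ≡-Reasoning
  lemma : ∀ x y z → x * - y * - z ≡ x * y * z
  lemma = solve-∀

-- The first-order expansion of a product around p² b = 0, where −1/q is given as g.
∏-perturb : ∀ p b q g n → (∀ i → i < n → q i * g i ≡ -1ℤ [mod p ]) →
            ∏ (λ i → q i + p * p * b) n ≡ ∏ q n * (1ℤ - p * p * b * ∑ g n) [mod cube p ]
∏-perturb p b q g zero    qg≡-1 = ≡⇒mod (lemma (p * p * b))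
  where
  lemma : ∀ d → 1ℤ ≡ 1ℤ * (1ℤ - d * 0ℤ)
  lemma = solve-∀
∏-perturb p b q g (suc n) qg≡-1 = begin
  ∏ (λ i → q i + D) n * (qₙ + D)
    ≈⟨ mod-*ʳ (qₙ + D) (∏-perturb p b q g n (λ i i<n → qg≡-1 i (ℕ.m<n⇒m<1+n i<n))) ⟩
  Q * (1ℤ - D * S) * (qₙ + D)
    -- Writing D as -D · (-1) lets -1 be replaced by qₙ gₙ: the two agree only modulo p, but D
    -- already carries p².
    ≡⟨ lemma₁ (Q * (1ℤ - D * S)) qₙ D ⟩
  Q * (1ℤ - D * S) * (qₙ - D * -1ℤ)
    ≈⟨ mod-*ˡ (Q * (1ℤ - D * S)) (mod-+ (mod-refl {x = qₙ}) (mod-neg (mod-scale p b (qg≡-1 n ℕ.≤-refl)))) ⟨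
  Q * (1ℤ - D * S) * (qₙ - D * (qₙ * gₙ))
    -- The discarded term is Q qₙ S gₙ D² with D² = p⁴ b², so one factor p remains in the quotient.
    ≈⟨ mod (Q * qₙ * S * gₙ * b * b * p) (lemma₂ Q b S qₙ gₙ p) ⟩
  Q * qₙ * (1ℤ - D * (S + gₙ)) ∎
  where
  open ModReasoning (cube p)
  D = p * p * b
  Q = ∏ q n
  S = ∑ g n
  qₙ = q n
  gₙ = g n
  mod-neg : ∀ {m x y} → x ≡ y [mod m ] → - x ≡ - y [mod m ]
  mod-neg {m} {y = y} (mod a refl) = mod (- a) (lemma y a m)
    where
    lemma : ∀ y a m → - (y + a * m) ≡ - y + - a * m
    lemma = solve-∀
  lemma₁ : ∀ x q d → x * (q + d) ≡ x * (q - d * -1ℤ)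
  lemma₁ = solve-∀
  lemma₂ : ∀ Q b S q g p →
    Q * (1ℤ - p * p * b * S) * (q - p * p * b * (q * g)) ≡
    Q * q * (1ℤ - p * p * b * (S + g)) + Q * q * S * g * b * b * p * (p * (p * p))
  lemma₂ = solve-∀

-- Sequences satisfying the Apéry recurrence

record IsAperySequence (x : ℤ) (t : ℕ → ℤ) : Set where
  field
    initial    : t 0 ≡ 1ℤ
    -- The denominator stays on the left, so that no division occurs and `x` may be any integer,
    -- negative ones included.
    recurrence : ∀ k → t (suc k) * ((1ℤ + + k) * (1ℤ + + k)) ≡
                       t k * ((x - + k) * (x + (1ℤ + + k)))

  -- The s relations starting at a telescope. Keeping the denominators as a product allows s = p,
  -- where one of them is divisible by p.
  recurrence-block : ∀ a s →
    t (a ℕ.+ s) * ∏ (λ i → (1ℤ + + (a ℕ.+ i)) * (1ℤ + + (a ℕ.+ i))) s ≡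
    t a * ∏ (λ i → (x - + (a ℕ.+ i)) * (x + (1ℤ + + (a ℕ.+ i)))) s
  recurrence-block a zero    = cong (λ k → t k * 1ℤ) (ℕ.+-identityʳ a)
  recurrence-block a (suc s) = begin
    t (a ℕ.+ suc s) * (A * E)             ≡⟨ cong (λ k → t k * (A * E)) (ℕ.+-suc a s) ⟩
    t (suc (a ℕ.+ s)) * (A * E)           ≡⟨ lemma₁ (t (suc (a ℕ.+ s))) A E ⟩
    t (suc (a ℕ.+ s)) * E * A             ≡⟨ cong (_* A) (recurrence (a ℕ.+ s)) ⟩
    t (a ℕ.+ s) * F * A                   ≡⟨ lemma₁ (t (a ℕ.+ s)) A F ⟨
    t (a ℕ.+ s) * (A * F)                 ≡⟨ ℤ.*-assoc (t (a ℕ.+ s)) A F ⟨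
    t (a ℕ.+ s) * A * F                   ≡⟨ cong (_* F) (recurrence-block a s) ⟩
    t a * B * F                           ≡⟨ ℤ.*-assoc (t a) B F ⟩
    t a * (B * F)                         ∎
    where
    open ≡-Reasoning
    A = ∏ (λ i → (1ℤ + + (a ℕ.+ i)) * (1ℤ + + (a ℕ.+ i))) s
    B = ∏ (λ i → (x - + (a ℕ.+ i)) * (x + (1ℤ + + (a ℕ.+ i)))) s
    E = (1ℤ + + (a ℕ.+ s)) * (1ℤ + + (a ℕ.+ s))
    F = (x - + (a ℕ.+ s)) * (x + (1ℤ + + (a ℕ.+ s)))
    lemma₁ : ∀ t A E → t * (A * E) ≡ t * E * A
    lemma₁ = solve-∀

-- The absorption identity, by induction through Pascal's rule.
[1+k]*[1+n]C[1+k]≡[1+n]*nCk : ∀ n k → suc k ℕ.* (suc n C suc k) ≡ suc n ℕ.* (n C k)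
[1+k]*[1+n]C[1+k]≡[1+n]*nCk n zero = begin
  1 ℕ.* (suc n C 1) ≡⟨ ℕ.*-identityˡ _ ⟩
  suc n C 1         ≡⟨ nC1≡n (suc n) ⟩
  suc n             ≡⟨ ℕ.*-identityʳ (suc n) ⟨
  suc n ℕ.* 1       ∎
  where open ≡-Reasoning
[1+k]*[1+n]C[1+k]≡[1+n]*nCk zero (suc k) = ℕ.*-zeroʳ (suc (suc k))
[1+k]*[1+n]C[1+k]≡[1+n]*nCk (suc n) (suc k) = begin
  suc (suc k) ℕ.* (suc (suc n) C suc (suc k))    ≡⟨ cong (suc (suc k) ℕ.*_) (nCk+nC[k+1]≡[n+1]C[k+1] (suc n) (suc k)) ⟨
  suc (suc k) ℕ.* (c ℕ.+ d)                      ≡⟨ lemma₁ k c d ⟩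
  suc k ℕ.* c ℕ.+ c ℕ.+ suc (suc k) ℕ.* d        ≡⟨ cong₂ (λ x y → x ℕ.+ c ℕ.+ y) ([1+k]*[1+n]C[1+k]≡[1+n]*nCk n k) ([1+k]*[1+n]C[1+k]≡[1+n]*nCk n (suc k)) ⟩
  suc n ℕ.* a ℕ.+ c ℕ.+ suc n ℕ.* b              ≡⟨ lemma₂ n a b c ⟩
  suc n ℕ.* (a ℕ.+ b) ℕ.+ c                      ≡⟨ cong (λ x → suc n ℕ.* x ℕ.+ c) (nCk+nC[k+1]≡[n+1]C[k+1] n k) ⟩
  suc n ℕ.* c ℕ.+ c                              ≡⟨ ℕ.+-comm _ c ⟩
  suc (suc n) ℕ.* c                              ∎
  where
  open ≡-Reasoning
  a = n C k
  b = n C suc k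
  c = suc n C suc k
  d = suc n C suc (suc k)
  lemma₁ : ∀ k c d → suc (suc k) ℕ.* (c ℕ.+ d) ≡ suc k ℕ.* c ℕ.+ c ℕ.+ suc (suc k) ℕ.* d
  lemma₁ = solveℕ-∀
  lemma₂ : ∀ n a b c → suc n ℕ.* a ℕ.+ c ℕ.+ suc n ℕ.* b ≡ suc n ℕ.* (a ℕ.+ b) ℕ.+ c
  lemma₂ = solveℕ-∀

-- Absorption and Pascal's rule give (k + 1)(c + c′) = (n + 1)c; subtracting (k + 1)c leaves the
-- claim. Over ℤ the case k > n needs no separate treatment.
[1+k]*nC[1+k]≡[n-k]*nCk : ∀ n k → (1ℤ + + k) * + (n C suc k) ≡ (+ n - + k) * + (n C k)
[1+k]*nC[1+k]≡[n-k]*nCk n k = begin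
  (1ℤ + + k) * c′                           ≡⟨ lemma₁ (+ k) c c′ ⟩
  (1ℤ + + k) * (c + c′) - (1ℤ + + k) * c    ≡⟨ cong (_- (1ℤ + + k) * c) absorb ⟩
  (1ℤ + + n) * c - (1ℤ + + k) * c           ≡⟨ lemma₂ (+ n) (+ k) c ⟩
  (+ n - + k) * c                           ∎
  where
  open ≡-Reasoning
  c = + (n C k)
  c′ = + (n C suc k)
  absorb : (1ℤ + + k) * (c + c′) ≡ (1ℤ + + n) * c
  absorb = begin
    + suc k * + (n C k ℕ.+ n C suc k)  ≡⟨ cong (λ z → + suc k * + z) (nCk+nC[k+1]≡[n+1]C[k+1] n k) ⟩
    + suc k * + (suc n C suc k)        ≡⟨ pos-* (suc k) _ ⟨
    + (suc k ℕ.* (suc n C suc k))      ≡⟨ cong +_ ([1+k]*[1+n]C[1+k]≡[1+n]*nCk n k) ⟩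
    + (suc n ℕ.* (n C k))              ≡⟨ pos-* (suc n) _ ⟩
    + suc n * c                        ∎
  lemma₁ : ∀ k c d → (1ℤ + k) * d ≡ (1ℤ + k) * (c + d) - (1ℤ + k) * c
  lemma₁ = solve-∀
  lemma₂ : ∀ n k c → (1ℤ + n) * c - (1ℤ + k) * c ≡ (n - k) * c
  lemma₂ = solve-∀

[1+k]*[n+1+k]C[1+k]≡[n+1+k]*[n+k]Ck : ∀ n k →
  (1ℤ + + k) * + ((n ℕ.+ suc k) C suc k) ≡ (+ n + (1ℤ + + k)) * + ((n ℕ.+ k) C k)
[1+k]*[n+1+k]C[1+k]≡[n+1+k]*[n+k]Ck n k = begin
  + suc k * + ((n ℕ.+ suc k) C suc k)        ≡⟨ cong (λ m → + suc k * + (m C suc k)) (ℕ.+-suc n k) ⟩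
  + suc k * + (suc (n ℕ.+ k) C suc k)        ≡⟨ pos-* (suc k) _ ⟨
  + (suc k ℕ.* (suc (n ℕ.+ k) C suc k))      ≡⟨ cong +_ ([1+k]*[1+n]C[1+k]≡[1+n]*nCk (n ℕ.+ k) k) ⟩
  + (suc (n ℕ.+ k) ℕ.* ((n ℕ.+ k) C k))      ≡⟨ pos-* (suc (n ℕ.+ k)) _ ⟩
  + suc (n ℕ.+ k) * + ((n ℕ.+ k) C k)        ≡⟨ cong (λ m → + m * + ((n ℕ.+ k) C k)) (ℕ.+-suc n k) ⟨
  + (n ℕ.+ suc k) * + ((n ℕ.+ k) C k)        ∎
  where open ≡-Reasoning

aperyRoot : ℕ → ℕ → ℤ
aperyRoot n k = + (n C k) * + ((n ℕ.+ k) C k)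

aperyRoot-isAperySequence : ∀ n → IsAperySequence (+ n) (aperyRoot n)
aperyRoot-isAperySequence n = record
  { initial    = refl
  ; recurrence = λ k → begin
      (+ (n C suc k) * + ((n ℕ.+ suc k) C suc k)) * ((1ℤ + + k) * (1ℤ + + k))
        ≡⟨ lemma (+ (n C suc k)) (+ ((n ℕ.+ suc k) C suc k)) (1ℤ + + k) (1ℤ + + k) ⟩
      ((1ℤ + + k) * + (n C suc k)) * ((1ℤ + + k) * + ((n ℕ.+ suc k) C suc k))
        ≡⟨ cong₂ _*_ ([1+k]*nC[1+k]≡[n-k]*nCk n k) ([1+k]*[n+1+k]C[1+k]≡[n+1+k]*[n+k]Ck n k) ⟩
      ((+ n - + k) * + (n C k)) * ((+ n + (1ℤ + + k)) * + ((n ℕ.+ k) C k))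
        ≡⟨ lemma (+ (n C k)) (+ ((n ℕ.+ k) C k)) (+ n - + k) (+ n + (1ℤ + + k)) ⟨
      (+ (n C k) * + ((n ℕ.+ k) C k)) * ((+ n - + k) * (+ n + (1ℤ + + k))) ∎
  }
  where
  open ≡-Reasoning
  lemma : ∀ a b x y → (a * b) * (x * y) ≡ (x * a) * (y * b)
  lemma = solve-∀

-- The numerator (x - k)(x + 1 + k) equals x(x + 1) - k(k + 1), which x ↦ -1 - x preserves.
IsAperySequence-reflect : ∀ {x t} → IsAperySequence x t → IsAperySequence (- (1ℤ + x)) t
IsAperySequence-reflect {x} {t} isApery = record
  { initial    = initial
  ; recurrence = λ k → trans (recurrence k) (cong (t k *_) (lemma x (+ k)))
  }
  where
  open IsAperySequence isApery
  lemma : ∀ x k → (x - k) * (x + (1ℤ + k)) ≡ (- (1ℤ + x) - k) * (- (1ℤ + x) + (1ℤ + k))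
  lemma = solve-∀

sumTo≡∑ : ∀ n {f : ℕ → ℕ} {g : ℕ → ℤ} → (∀ k → + f k ≡ g k) → + sumTo n f ≡ ∑ g (suc n)
sumTo≡∑ zero    {g = g} f≡g = trans (f≡g 0) (sym (ℤ.+-identityˡ (g 0)))
sumTo≡∑ (suc n) f≡g = cong₂ _+_ (sumTo≡∑ n f≡g) (f≡g (suc n))

apery≡∑ : ∀ n → + apery n ≡ ∑ (λ k → aperyRoot n k * aperyRoot n k) (suc n)
apery≡∑ n = sumTo≡∑ n λ k → expand (n C k) ((n ℕ.+ k) C k)
  where
  lemma : ∀ a b → (a * a) * (b * b) ≡ (a * b) * (a * b)
  lemma = solve-∀
  expand : ∀ a b → + ((a ℕ.* a) ℕ.* (b ℕ.* b)) ≡ (+ a * + b) * (+ a * + b)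
  expand a b = trans (pos-* (a ℕ.* a) (b ℕ.* b))
                     (trans (cong₂ _*_ (pos-* a a) (pos-* b b)) (lemma (+ a) (+ b)))

-- The extra terms contain C(n, k) with k > n. They serve to fill up the last block of length p when
-- n is a multiple of p.
apery≡∑-extended : ∀ n e → + apery n ≡ ∑ (λ k → aperyRoot n k * aperyRoot n k) (suc n ℕ.+ e)
apery≡∑-extended n zero    = trans (apery≡∑ n) (cong (∑ _) (sym (ℕ.+-identityʳ (suc n))))
apery≡∑-extended n (suc e) = begin
  + apery n                             ≡⟨ apery≡∑-extended n e ⟩
  ∑ q (suc n ℕ.+ e)                     ≡⟨ ℤ.+-identityʳ _ ⟨
  ∑ q (suc n ℕ.+ e) + 0ℤ                ≡⟨ cong (λ c → ∑ q (suc n ℕ.+ e) + (+ c * + b) * (+ c * + b)) (k>n⇒nCk≡0 (s≤s (ℕ.m≤m+n n e))) ⟨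
  ∑ q (suc n ℕ.+ e) + q (suc n ℕ.+ e)   ≡⟨ cong (∑ q) (ℕ.+-suc (suc n) e) ⟨
  ∑ q (suc n ℕ.+ suc e)                 ∎
  where
  open ≡-Reasoning
  q : ℕ → ℤ
  q k = aperyRoot n k * aperyRoot n k
  b = (n ℕ.+ (suc n ℕ.+ e)) C (suc n ℕ.+ e)

-- Arithmetic modulo p and p³

module OddPrime (p h : ℕ) .{{_ : NonZero p}} (p-prime : Prime p) (p>3 : 3 < p)
                (p≡1+2h : p ≡ suc (h ℕ.+ h)) where

  P P³ : ℤ
  P = + p
  P³ = cube P

  -- Total in r, with the dummy value 0 outside 0 < r < p and the range a hypothesis of the property
  -- only, so that reciprocals can be summed without range proofs as arguments.
  inverse : ∀ r → ∃ λ g → 0 < r → r < p → + r * g ≡ 1ℤ [mod P ]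
  inverse zero    = 0ℤ , λ ()
  inverse (suc r) with suc r ℕ.<? p
  ... | no r≮p = 0ℤ , λ _ r<p → contradiction r<p r≮p
  ... | yes r<p with coprime-Bézout (prime⇒coprime p-prime r<p)
  -- Bézout's identity has two signs: 1 + y r = x p gives the reciprocal -y, and 1 + x p = y r gives
  -- y.
  ...   | Bézout.+- x y eq = - + y , λ _ _ → mod (- + x) (begin
    R * - + y                               ≡⟨ lemma₁ R (+ y) ⟩
    1ℤ - (1ℤ + + y * R)                     ≡⟨ cong (λ z → 1ℤ - (1ℤ + z)) (pos-* y (suc r)) ⟨
    1ℤ - + (1 ℕ.+ y ℕ.* suc r)              ≡⟨ cong (λ z → 1ℤ - + z) eq ⟩
    1ℤ - + (x ℕ.* p)                        ≡⟨ cong (λ z → 1ℤ - z) (pos-* x p) ⟩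
    1ℤ - + x * P                            ≡⟨ lemma₂ (+ x) P ⟩
    1ℤ + - + x * P                          ∎)
    where
    open ≡-Reasoning
    R = + suc r
    lemma₁ : ∀ R y → R * - y ≡ 1ℤ - (1ℤ + y * R)
    lemma₁ = solve-∀
    lemma₂ : ∀ x P → 1ℤ - x * P ≡ 1ℤ + - x * P
    lemma₂ = solve-∀
  ...   | Bézout.-+ x y eq = + y , λ _ _ → mod (+ x) (begin
    + suc r * + y             ≡⟨ ℤ.*-comm (+ suc r) (+ y) ⟩
    + y * + suc r             ≡⟨ pos-* y (suc r) ⟨
    + (y ℕ.* suc r)           ≡⟨ cong +_ eq ⟨
    1ℤ + + (x ℕ.* p)          ≡⟨ cong (λ z → 1ℤ + z) (pos-* x p) ⟩
    1ℤ + + x * P              ∎)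
    where open ≡-Reasoning

  invertible : ∀ {r} → 0 < r → r < p → Invertible P (+ r)
  invertible {r} 0<r r<p = unit (proj₁ (inverse r)) (proj₂ (inverse r) 0<r r<p)

  -- Sums of inverse squares modulo p

  r⁻² : ℕ → ℤ
  r⁻² r = proj₁ (inverse r) * proj₁ (inverse r)

  r²r⁻²≡1 : ∀ {r} → 0 < r → r < p → (+ r * + r) * r⁻² r ≡ 1ℤ [mod P ]
  r²r⁻²≡1 {r} 0<r r<p =
    mod-trans (≡⇒mod (lemma (+ r) (proj₁ (inverse r))))
              (mod-* {x = + r * proj₁ (inverse r)} (proj₂ (inverse r) 0<r r<p) (proj₂ (inverse r) 0<r r<p))
    where
    lemma : ∀ r g → (r * r) * (g * g) ≡ (r * g) * (r * g)
    lemma = solve-∀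

  -- r² - s² = (r - s)(r + s) is a multiple of p, so r² and s² have the same inverse.
  r⁻²-reflect : ∀ {r s} → 0 < r → 0 < s → r ℕ.+ s ≡ p → r⁻² r ≡ r⁻² s [mod P ]
  r⁻²-reflect {r} {s} 0<r 0<s r+s≡p =
    inverse-unique {a = + r * + r} {b = + s * + s}
                   (r²r⁻²≡1 0<r (subst (r <_) r+s≡p (ℕ.m<m+n r 0<s)))
                   (r²r⁻²≡1 0<s (subst (s <_) r+s≡p (ℕ.m<n+m s 0<r)))
                   (mod (+ r - + s) (trans (lemma (+ r) (+ s)) (cong (λ k → + s * + s + (+ r - + s) * + k) r+s≡p)))
    where
    lemma : ∀ r s → r * r ≡ s * s + (r - s) * (r + s)
    lemma = solve-∀

  -- Since (2r)² = 4r², the number 4 · (2r)⁻² is another inverse of r².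
  r⁻²-double : ∀ {r} → 0 < r → r ℕ.+ r < p → + 4 * r⁻² (r ℕ.+ r) ≡ r⁻² r [mod P ]
  r⁻²-double {r} 0<r 2r<p =
    inverse-unique {a = + r * + r} {b = + r * + r}
                   (mod-trans (≡⇒mod (lemma (+ r) (r⁻² (r ℕ.+ r)))) (r²r⁻²≡1 (ℕ.+-mono-<-≤ 0<r z≤n) 2r<p))
                   (r²r⁻²≡1 0<r (ℕ.≤-<-trans (ℕ.m≤m+n r r) 2r<p))
                   (mod-refl {x = + r * + r})
    where
    lemma : ∀ r g → (r * r) * (+ 4 * g) ≡ ((r + r) * (r + r)) * g
    lemma = solve-∀

  -- Reversing the upper half of 1, ..., p - 1 puts p - (i + 1) in position i, opposite i + 1 in the
  -- lower half.
  h-reflect : ∀ {i} → i < h → suc (h ℕ.+ (h ∸ suc i)) ℕ.+ suc i ≡ p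
  h-reflect {i} i<h = begin
    suc (h ℕ.+ (h ∸ suc i)) ℕ.+ suc i  ≡⟨ cong suc (ℕ.+-assoc h (h ∸ suc i) (suc i)) ⟩
    suc (h ℕ.+ (h ∸ suc i ℕ.+ suc i))  ≡⟨ cong (λ k → suc (h ℕ.+ k)) (ℕ.m∸n+n≡m i<h) ⟩
    suc (h ℕ.+ h)                      ≡⟨ p≡1+2h ⟨
    p                                  ∎
    where open ≡-Reasoning

  i<2h⇒1+i<p : ∀ {i} → i < h ℕ.+ h → suc i < p
  i<2h⇒1+i<p {i} i<2h = subst (suc i <_) (sym p≡1+2h) (s≤s i<2h)

  i<h⇒2[1+i]<p : ∀ {i} → i < h → suc i ℕ.+ suc i < p
  i<h⇒2[1+i]<p {i} i<h = subst (suc i ℕ.+ suc i <_) (sym p≡1+2h) (s≤s (ℕ.+-mono-≤ i<h i<h))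

  i<h⇒1+i<p : ∀ {i} → i < h → suc i < p
  i<h⇒1+i<p i<h = i<2h⇒1+i<p (ℕ.<-≤-trans i<h (ℕ.m≤m+n h h))

  -- Index i stands for r = i + 1, so `S h` runs over 0 < r ≤ (p - 1)/2 and `S (h ℕ.+ h)` over 0 < r
  -- < p.
  S : ℕ → ℤ
  S = ∑ (λ i → r⁻² (suc i))

  S-even : ℤ
  S-even = ∑ (λ i → r⁻² (suc (suc (i ℕ.+ i)))) h

  S[2h]≡2S[h] : S (h ℕ.+ h) ≡ S h + S h [mod P ]
  S[2h]≡2S[h] = begin
    S (h ℕ.+ h)                                       ≡⟨ ∑-++ (λ i → r⁻² (suc i)) h h ⟩
    S h + ∑ (λ i → r⁻² (suc (h ℕ.+ i))) h             ≡⟨ cong (λ z → S h + z) (∑-reverse (λ i → r⁻² (suc (h ℕ.+ i))) h) ⟩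
    S h + ∑ (λ i → r⁻² (suc (h ℕ.+ (h ∸ suc i)))) h   ≈⟨ mod-+ (mod-refl {x = S h}) (∑-mod h λ i i<h → r⁻²-reflect z<s z<s (h-reflect i<h)) ⟩
    S h + S h                                         ∎
    where open ModReasoning P

  -- As p is odd, r ↦ p - r exchanges odd and even r.
  S[2h]≡2S-even : S (h ℕ.+ h) ≡ S-even + S-even [mod P ]
  S[2h]≡2S-even = begin
    -- By the shift r = i + 1, even indices carry the odd r.
    S (h ℕ.+ h)                                                        ≡⟨ ∑-parity (λ i → r⁻² (suc i)) h ⟩
    ∑ (λ i → r⁻² (suc (i ℕ.+ i))) h + S-even                           ≡⟨ cong (_+ S-even) (∑-reverse (λ i → r⁻² (suc (i ℕ.+ i))) h) ⟩
    ∑ (λ i → r⁻² (suc ((h ∸ suc i) ℕ.+ (h ∸ suc i)))) h + S-even       ≈⟨ mod-+ (∑-mod h λ i i<h → r⁻²-reflect z<s z<s (reflect i<h)) (mod-refl {x = S-even}) ⟩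
    S-even + S-even                                                    ∎
    where
    open ModReasoning P
    reflect : ∀ {i} → i < h → suc ((h ∸ suc i) ℕ.+ (h ∸ suc i)) ℕ.+ suc (suc (i ℕ.+ i)) ≡ p
    reflect {i} i<h = trans (cong suc (trans (shuffle (h ∸ suc i) i) (cong (λ k → k ℕ.+ k) (ℕ.m∸n+n≡m i<h)))) (sym p≡1+2h)
      where
      shuffle : ∀ a i → a ℕ.+ a ℕ.+ suc (suc (i ℕ.+ i)) ≡ (a ℕ.+ suc i) ℕ.+ (a ℕ.+ suc i)
      shuffle = solveℕ-∀

  -- The even r are the doubles of 1, ..., h.
  4S-even≡S[h] : + 4 * S-even ≡ S h [mod P ]
  4S-even≡S[h] = begin
    + 4 * S-even                                         ≡⟨ *-distribˡ-∑ (+ 4) (λ i → r⁻² (suc (suc (i ℕ.+ i)))) h ⟩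
    ∑ (λ i → + 4 * r⁻² (suc (suc (i ℕ.+ i)))) h          ≡⟨ ∑-cong h (λ i _ → cong (λ k → + 4 * r⁻² (suc k)) (ℕ.+-suc i i)) ⟨
    ∑ (λ i → + 4 * r⁻² (suc i ℕ.+ suc i)) h              ≈⟨ ∑-mod h (λ i i<h → r⁻²-double z<s (i<h⇒2[1+i]<p i<h)) ⟩
    S h                                                  ∎
    where open ModReasoning P

  S[h]≡0 : S h ≡ 0ℤ [mod P ]
  -- 3 is a unit because p > 3. With s for `S h`, the chain computes 3s = 4s - s and 4s ≡ 4 `S-even`
  -- ≡ s.
  S[h]≡0 = *-cancelˡ-mod (invertible (z<s {2}) p>3) (begin
    + 3 * S h                             ≡⟨ lemma₁ (S h) ⟩
    + 2 * (S h + S h) - S h               ≈⟨ mod-+ (mod-*ˡ (+ 2) (mod-trans (mod-sym S[2h]≡2S[h]) S[2h]≡2S-even)) (mod-refl {x = - S h}) ⟩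
    + 2 * (S-even + S-even) - S h         ≡⟨ cong (_- S h) (lemma₂ S-even) ⟩
    + 4 * S-even - S h                    ≈⟨ mod-+ 4S-even≡S[h] (mod-refl {x = - S h}) ⟩
    S h - S h                             ≡⟨ lemma₃ (S h) ⟩
    + 3 * 0ℤ                              ∎)
    where
    open ModReasoning P
    lemma₁ : ∀ s → + 3 * s ≡ + 2 * (s + s) - s
    lemma₁ = solve-∀
    lemma₂ : ∀ s → + 2 * (s + s) ≡ + 4 * s
    lemma₂ = solve-∀
    lemma₃ : ∀ s → s - s ≡ 0ℤ
    lemma₃ = solve-∀

  S[2h]≡0 : S (h ℕ.+ h) ≡ 0ℤ [mod P ]
  S[2h]≡0 = mod-trans S[2h]≡2S[h] (mod-+ S[h]≡0 S[h]≡0)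

  -- Block products modulo p³

  W : ℤ → ℤ
  W a = ∏ (λ i → P * a + (1ℤ + + i)) (h ℕ.+ h)

  pair : ℕ → ℤ
  pair i = (1ℤ + + i) * (P - (1ℤ + + i))

  -- With r = i + 1, `pair i` is r(p - r) ≡ -r², so r⁻² takes the place of -1/q in `∏-perturb`.
  pair-inverse : ∀ i → i < h → pair i * r⁻² (suc i) ≡ -1ℤ [mod P ]
  pair-inverse i i<h = begin
    pair i * g                                ≈⟨ mod (r * g) (lemma₁ r P g) ⟩
    -1ℤ * (r * r * g)                         ≈⟨ mod-*ˡ -1ℤ (r²r⁻²≡1 z<s (i<h⇒1+i<p i<h)) ⟩
    -1ℤ                                       ∎
    where
    open ModReasoning P
    r = + suc i
    g = r⁻² (suc i)
    lemma₁ : ∀ r P g → r * (P - r) * g ≡ -1ℤ * (r * r * g) + r * g * P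
    lemma₁ = solve-∀

  -- This is (p - 1)! with r and p - r grouped together, that is, `W 0ℤ` in paired form.
  w : ℤ
  w = ∏ pair h

  w-invertible : Invertible P w
  w-invertible = Invertible-∏ h λ i i<h →
    unit (- r⁻² (suc i)) (mod-trans (≡⇒mod (lemma (pair i) (r⁻² (suc i)))) (mod-*ˡ -1ℤ (pair-inverse i i<h)))
    where
    lemma : ∀ q g → q * - g ≡ -1ℤ * (q * g)
    lemma = solve-∀

  -- The factors at r and p - r multiply to r(p - r) + p² a(a + 1). The perturbation is the same for
  -- every pair, so to first order it contributes a multiple of p² `S h`, which is 0 modulo p³.
  W-const : ∀ a → W a ≡ w [mod P³ ]
  W-const a = begin
    W a                                             ≡⟨ ∏-++ f h h ⟩
    ∏ f h * ∏ (λ i → f (h ℕ.+ i)) h                 ≡⟨ cong (∏ f h *_) (∏-reverse (λ i → f (h ℕ.+ i)) h) ⟩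
    ∏ f h * ∏ (λ i → f (h ℕ.+ (h ∸ suc i))) h       ≡⟨ ∏-* f (λ i → f (h ℕ.+ (h ∸ suc i))) h ⟨
    ∏ (λ i → f i * f (h ℕ.+ (h ∸ suc i))) h         ≡⟨ ∏-cong h paired ⟩
    ∏ (λ i → pair i + P * P * b) h                  ≈⟨ ∏-perturb P b pair (λ i → r⁻² (suc i)) h pair-inverse ⟩
    w * (1ℤ - P * P * b * S h)                      ≡⟨ lemma₁ w (P * P * b * S h) ⟩
    w + - w * (P * P * b * S h)                     ≈⟨ mod-+ (mod-refl {x = w}) (mod-*ˡ (- w) (mod-scale P b S[h]≡0)) ⟩
    w + - w * (P * P * b * 0ℤ)                      ≡⟨ lemma₂ w (P * P * b) ⟩
    w                                               ∎
    where
    open ModReasoning P³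
    b = a * (a + 1ℤ)
    f : ℕ → ℤ
    f i = P * a + (1ℤ + + i)
    lemma₁ : ∀ w d → w * (1ℤ - d) ≡ w + - w * d
    lemma₁ = solve-∀
    lemma₂ : ∀ w d → w + - w * (d * 0ℤ) ≡ w
    lemma₂ = solve-∀
    lemma₃ : ∀ r s → s ≡ s + r - r
    lemma₃ = solve-∀
    lemma₄ : ∀ P a r → (P * a + r) * (P * a + (P - r)) ≡ r * (P - r) + P * P * (a * (a + 1ℤ))
    lemma₄ = solve-∀
    paired : ∀ i → i < h → f i * f (h ℕ.+ (h ∸ suc i)) ≡ pair i + P * P * b
    paired i i<h = trans
      (cong (λ z → f i * (P * a + z))
        (trans (lemma₃ (+ suc i) (+ suc (h ℕ.+ (h ∸ suc i)))) (cong (λ k → + k - + suc i) (h-reflect i<h))))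
      (lemma₄ P a (1ℤ + + i))

  -- Comparison of the sequences for p N and N at multiples of p

  module Supercongruence (N : ℤ) {t u : ℕ → ℤ}
                         (t-apery : IsAperySequence (P * N) t) (u-apery : IsAperySequence N u) where
    open IsAperySequence t-apery renaming
      (initial to t-initial; recurrence to t-recurrence; recurrence-block to t-recurrence-block)
    open IsAperySequence u-apery renaming (initial to u-initial; recurrence to u-recurrence)

    +[jp+i] : ∀ j i → + (j ℕ.* p ℕ.+ i) ≡ P * + j + + i
    +[jp+i] j i = cong (_+ + i) (trans (pos-* j p) (ℤ.*-comm (+ j) P))

    -- Among jp + 1, ..., jp + p the last is p(j + 1) and the others form `W (+ j)`; everything is
    -- squared.
    denominators : ∀ j →
      ∏ (λ i → (1ℤ + + (j ℕ.* p ℕ.+ i)) * (1ℤ + + (j ℕ.* p ℕ.+ i))) p ≡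
      P * P * ((1ℤ + + j) * (1ℤ + + j)) * (W (+ j) * W (+ j))
    denominators j = begin
      ∏ (λ i → f i * f i) p                       ≡⟨ ∏-* f f p ⟩
      ∏ f p * ∏ f p                               ≡⟨ cong (λ z → z * z) ∏f ⟩
      (V * (P * J)) * (V * (P * J))               ≡⟨ lemma₂ V P J ⟩
      P * P * (J * J) * (V * V)                   ∎
      where
      open ≡-Reasoning
      f : ℕ → ℤ
      f i = 1ℤ + + (j ℕ.* p ℕ.+ i)
      J = 1ℤ + + j
      V = W (+ j)
      lemma₁ : ∀ P j i → 1ℤ + (P * j + i) ≡ P * j + (1ℤ + i)
      lemma₁ = solve-∀
      lemma₂ : ∀ V P J → (V * (P * J)) * (V * (P * J)) ≡ P * P * (J * J) * (V * V)
      lemma₂ = solve-∀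
      lemma₃ : ∀ P j → P * j + P ≡ P * (1ℤ + j)
      lemma₃ = solve-∀
      f≡ : ∀ i → f i ≡ P * + j + (1ℤ + + i)
      f≡ i = trans (cong (λ z → 1ℤ + z) (+[jp+i] j i)) (lemma₁ P (+ j) (+ i))
      ∏f : ∏ f p ≡ V * (P * J)
      ∏f = begin
        ∏ f p                                  ≡⟨ cong (∏ f) p≡1+2h ⟩
        ∏ f (h ℕ.+ h) * f (h ℕ.+ h)            ≡⟨ cong₂ _*_ (∏-cong (h ℕ.+ h) (λ i _ → f≡ i)) (f≡ (h ℕ.+ h)) ⟩
        V * (P * + j + + suc (h ℕ.+ h))        ≡⟨ cong (λ k → V * (P * + j + + k)) p≡1+2h ⟨
        V * (P * + j + P)                      ≡⟨ cong (V *_) (lemma₃ P (+ j)) ⟩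
        V * (P * J)                            ∎

    -- The factors pN - (jp + i) start with p(N - j), and the remaining p - 1 are those of
    -- `W (+ j - N)` with all signs changed. The factors pN + jp + i + 1 run through those of
    -- `W (N + + j)` and end with p(N + j + 1).
    numerators : ∀ j →
      ∏ (λ i → (P * N - + (j ℕ.* p ℕ.+ i)) * (P * N + (1ℤ + + (j ℕ.* p ℕ.+ i)))) p ≡
      P * P * ((N - + j) * (N + (1ℤ + + j))) * (W (+ j - N) * W (N + + j))
    numerators j = begin
      ∏ (λ i → f i * g i) p                                  ≡⟨ ∏-* f g p ⟩
      ∏ f p * ∏ g p                                          ≡⟨ cong₂ _*_ ∏f ∏g ⟩
      (P * (N - + j) * V₁) * (V₂ * (P * (N + (1ℤ + + j))))   ≡⟨ lemma₁ P (N - + j) V₁ V₂ (N + (1ℤ + + j)) ⟩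
      P * P * ((N - + j) * (N + (1ℤ + + j))) * (V₁ * V₂)     ∎
      where
      open ≡-Reasoning
      f g : ℕ → ℤ
      f i = P * N - + (j ℕ.* p ℕ.+ i)
      g i = P * N + (1ℤ + + (j ℕ.* p ℕ.+ i))
      V₁ = W (+ j - N)
      V₂ = W (N + + j)
      lemma₁ : ∀ P a V₁ V₂ b → (P * a * V₁) * (V₂ * (P * b)) ≡ P * P * (a * b) * (V₁ * V₂)
      lemma₁ = solve-∀
      lemma₂ : ∀ P N j i → P * N - (P * j + i) ≡ - (P * (j - N) + i)
      lemma₂ = solve-∀
      lemma₃ : ∀ P N j → P * N - (P * j + 0ℤ) ≡ P * (N - j)
      lemma₃ = solve-∀
      lemma₄ : ∀ P N j i → P * N + (1ℤ + (P * j + i)) ≡ P * (N + j) + (1ℤ + i)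
      lemma₄ = solve-∀
      lemma₅ : ∀ P N j → P * (N + j) + P ≡ P * (N + (1ℤ + j))
      lemma₅ = solve-∀
      ∏f : ∏ f p ≡ P * (N - + j) * V₁
      ∏f = begin
        ∏ f p                                        ≡⟨ cong (∏ f) p≡1+2h ⟩
        ∏ f (suc (h ℕ.+ h))                          ≡⟨ ∏-first f (h ℕ.+ h) ⟩
        f 0 * ∏ (λ i → f (suc i)) (h ℕ.+ h)
          ≡⟨ cong₂ _*_ (trans (cong (λ z → P * N - z) (+[jp+i] j 0)) (lemma₃ P N (+ j)))
                       (∏-cong (h ℕ.+ h) (λ i _ → trans (cong (λ z → P * N - z) (+[jp+i] j (suc i))) (lemma₂ P N (+ j) (+ suc i)))) ⟩
        P * (N - + j) * ∏ (λ i → - (P * (+ j - N) + (1ℤ + + i))) (h ℕ.+ h)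
          ≡⟨ cong (P * (N - + j) *_) (∏-neg (λ i → P * (+ j - N) + (1ℤ + + i)) h) ⟩
        P * (N - + j) * V₁                           ∎
      g≡ : ∀ i → g i ≡ P * (N + + j) + (1ℤ + + i)
      g≡ i = trans (cong (λ z → P * N + (1ℤ + z)) (+[jp+i] j i)) (lemma₄ P N (+ j) (+ i))
      ∏g : ∏ g p ≡ V₂ * (P * (N + (1ℤ + + j)))
      ∏g = begin
        ∏ g p                                        ≡⟨ cong (∏ g) p≡1+2h ⟩
        ∏ g (h ℕ.+ h) * g (h ℕ.+ h)                  ≡⟨ cong₂ _*_ (∏-cong (h ℕ.+ h) (λ i _ → g≡ i)) (g≡ (h ℕ.+ h)) ⟩
        V₂ * (P * (N + + j) + + suc (h ℕ.+ h))       ≡⟨ cong (λ k → V₂ * (P * (N + + j) + + k)) p≡1+2h ⟨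
        V₂ * (P * (N + + j) + P)                     ≡⟨ cong (V₂ *_) (lemma₅ P N (+ j)) ⟩
        V₂ * (P * (N + (1ℤ + + j)))                  ∎

    -- A block of p steps has p² on both sides. Once it is cancelled over ℤ, what remains is the
    -- recurrence of `u` up to block products.
    t-recurrence-p : ∀ j →
      t (suc j ℕ.* p) * ((1ℤ + + j) * (1ℤ + + j)) * (W (+ j) * W (+ j)) ≡
      t (j ℕ.* p) * ((N - + j) * (N + (1ℤ + + j))) * (W (+ j - N) * W (N + + j))
    t-recurrence-p j = ℤ.*-cancelˡ-≡ P _ _ (ℤ.*-cancelˡ-≡ P _ _ (begin
      P * (P * (T′ * D * V))       ≡⟨ lemma P T′ D V ⟩
      T′ * (P * P * D * V)         ≡⟨ cong₂ (λ k z → t k * z) (ℕ.+-comm (j ℕ.* p) p) (denominators j) ⟨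
      t (j ℕ.* p ℕ.+ p) * ∏ (λ i → (1ℤ + + (j ℕ.* p ℕ.+ i)) * (1ℤ + + (j ℕ.* p ℕ.+ i))) p
                                   ≡⟨ t-recurrence-block (j ℕ.* p) p ⟩
      T * ∏ (λ i → (P * N - + (j ℕ.* p ℕ.+ i)) * (P * N + (1ℤ + + (j ℕ.* p ℕ.+ i)))) p
                                   ≡⟨ cong (T *_) (numerators j) ⟩
      T * (P * P * E * V′)         ≡⟨ lemma P T E V′ ⟨
      P * (P * (T * E * V′))       ∎))
      where
      open ≡-Reasoning
      T = t (j ℕ.* p)
      T′ = t (suc j ℕ.* p)
      D = (1ℤ + + j) * (1ℤ + + j)
      E = (N - + j) * (N + (1ℤ + + j))
      V = W (+ j) * W (+ j)
      V′ = W (+ j - N) * W (N + + j)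
      lemma : ∀ P T D V → P * (P * (T * D * V)) ≡ T * (P * P * D * V)
      lemma = solve-∀

    -- The recurrences divide by (j + 1)², which need not be invertible modulo p³, so t(jp) and u(j)
    -- are compared through an exact proportion t(jp) : u(j) = Y : X.
    t[jp]∝u[j] : ∀ j → ∃ λ X → ∃ λ Y → Invertible P X × X ≡ Y [mod P³ ] × t (j ℕ.* p) * X ≡ u j * Y
    t[jp]∝u[j] zero    = 1ℤ , 1ℤ , unit 1ℤ mod-refl , mod-refl ,
                         cong (_* 1ℤ) (trans t-initial (sym u-initial))
    t[jp]∝u[j] (suc j) with t[jp]∝u[j] j
    ... | X , Y , X-inv , X≡Y , tX≡uY =
      -- Each step puts W(j)² into X and W(j - N) W(N + j) into Y; both are w² modulo p³.
      X * V , Y * V′ ,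
      Invertible-* X-inv (Invertible-* W-inv W-inv) ,
      mod-* X≡Y (mod-trans (V≡w² (+ j) (+ j)) (mod-sym (V≡w² (+ j - N) (N + + j)))) ,
      -- (j + 1)² is cancelled as a nonzero integer, whatever its divisibility by p.
      ℤ.*-cancelʳ-≡ _ _ D (begin
        T′ * (X * V) * D      ≡⟨ lemma₁ T′ X V D ⟩
        (T′ * D * V) * X      ≡⟨ cong (_* X) (t-recurrence-p j) ⟩
        (T * E * V′) * X      ≡⟨ lemma₂ T E V′ X ⟩
        (T * X) * (E * V′)    ≡⟨ cong (_* (E * V′)) tX≡uY ⟩
        (u j * Y) * (E * V′)  ≡⟨ lemma₃ (u j) Y E V′ ⟩
        (u j * E) * (Y * V′)  ≡⟨ cong (_* (Y * V′)) (u-recurrence j) ⟨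
        (u (suc j) * D) * (Y * V′) ≡⟨ lemma₄ (u (suc j)) D (Y * V′) ⟩
        u (suc j) * (Y * V′) * D   ∎)
      where
      open ≡-Reasoning
      T = t (j ℕ.* p)
      T′ = t (suc j ℕ.* p)
      D = (1ℤ + + j) * (1ℤ + + j)
      E = (N - + j) * (N + (1ℤ + + j))
      V = W (+ j) * W (+ j)
      V′ = W (+ j - N) * W (N + + j)
      V≡w² : ∀ a b → W a * W b ≡ w * w [mod P³ ]
      V≡w² a b = mod-* (W-const a) (W-const b)
      W-inv : Invertible P (W (+ j))
      W-inv = Invertible-resp (mod-cube⇒mod P (mod-sym (W-const (+ j)))) w-invertible
      lemma₁ : ∀ T X V D → T * (X * V) * D ≡ (T * D * V) * X
      lemma₁ = solve-∀
      lemma₂ : ∀ T E V X → (T * E * V) * X ≡ (T * X) * (E * V)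
      lemma₂ = solve-∀
      lemma₃ : ∀ u Y E V → (u * Y) * (E * V) ≡ (u * E) * (Y * V)
      lemma₃ = solve-∀
      lemma₄ : ∀ u D Y → (u * D) * Y ≡ u * Y * D
      lemma₄ = solve-∀

    t[jp]≡u[j] : ∀ j → t (j ℕ.* p) ≡ u j [mod P³ ]
    t[jp]≡u[j] j with t[jp]∝u[j] j
    ... | X , Y , X-inv , X≡Y , tX≡uY = *-cancelˡ-mod (Invertible-cube X-inv) (begin
      X * t (j ℕ.* p)  ≡⟨ ℤ.*-comm X _ ⟩
      t (j ℕ.* p) * X  ≡⟨ tX≡uY ⟩
      u j * Y          ≈⟨ mod-*ˡ (u j) X≡Y ⟨
      u j * X          ≡⟨ ℤ.*-comm (u j) X ⟩
      X * u j          ∎)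
      where open ModReasoning P³

    t² u² : ℕ → ℤ
    t² k = t k * t k
    u² k = u k * u k

    -- Terms at indices jp + r with 0 < r < p

    module Block (j : ℕ) where

      jp+_ : ℕ → ℕ
      jp+ i = j ℕ.* p ℕ.+ i

      +[jp+i]≡i : ∀ i → + (jp+ i) ≡ + i [mod P ]
      +[jp+i]≡i i = mod (+ j) (trans (cong (_+ + i) (pos-* j p)) (ℤ.+-comm (+ j * P) (+ i)))

      1+[jp+i]≡1+i : ∀ i → 1ℤ + + (jp+ i) ≡ + suc i [mod P ]
      1+[jp+i]≡1+i i = mod-+ (mod-refl {x = 1ℤ}) (+[jp+i]≡i i)

      1+i-invertible : ∀ {i} → i < h ℕ.+ h → Invertible P (+ suc i)
      1+i-invertible i<2h = invertible z<s (i<2h⇒1+i<p i<2h)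

      -- Modulo p the summand pN drops out and jp + i becomes i. At i = 0 the result is 0, which is
      -- how p enters `t`.
      numerator≡ : ∀ i → (P * N - + (jp+ i)) * (P * N + (1ℤ + + (jp+ i))) ≡ - (+ i * + suc i) [mod P ]
      numerator≡ i = begin
        (P * N - + (jp+ i)) * (P * N + (1ℤ + + (jp+ i)))
          ≈⟨ mod (N * (P * N + 1ℤ)) (lemma₁ P N (+ (jp+ i))) ⟩
        -1ℤ * (+ (jp+ i) * (1ℤ + + (jp+ i)))
          ≈⟨ mod-*ˡ -1ℤ (mod-* (+[jp+i]≡i i) (1+[jp+i]≡1+i i)) ⟩
        -1ℤ * (+ i * + suc i)
          ≡⟨ ℤ.-1*i≡-i (+ i * + suc i) ⟩
        - (+ i * + suc i)  ∎
        where
        open ModReasoning P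
        lemma₁ : ∀ P N k → (P * N - k) * (P * N + (1ℤ + k)) ≡ -1ℤ * (k * (1ℤ + k)) + N * (P * N + 1ℤ) * P
        lemma₁ = solve-∀

      t-reduced : ∀ i → (+ suc i * + suc i) * t (jp+ suc i) ≡ - (+ i * + suc i) * t (jp+ i) [mod P ]
      t-reduced i = begin
        (+ suc i * + suc i) * t (jp+ suc i)
          ≈⟨ mod-*ʳ (t (jp+ suc i)) (mod-* (1+[jp+i]≡1+i i) (1+[jp+i]≡1+i i)) ⟨
        ((1ℤ + + (jp+ i)) * (1ℤ + + (jp+ i))) * t (jp+ suc i)
          ≡⟨ ℤ.*-comm _ (t (jp+ suc i)) ⟩
        t (jp+ suc i) * ((1ℤ + + (jp+ i)) * (1ℤ + + (jp+ i)))
          ≡⟨ cong (λ k → t k * ((1ℤ + + (jp+ i)) * (1ℤ + + (jp+ i)))) (ℕ.+-suc (j ℕ.* p) i) ⟩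
        t (suc (jp+ i)) * ((1ℤ + + (jp+ i)) * (1ℤ + + (jp+ i)))
          ≡⟨ t-recurrence (jp+ i) ⟩
        t (jp+ i) * ((P * N - + (jp+ i)) * (P * N + (1ℤ + + (jp+ i))))
          ≈⟨ mod-*ˡ (t (jp+ i)) (numerator≡ i) ⟩
        t (jp+ i) * - (+ i * + suc i)
          ≡⟨ ℤ.*-comm (t (jp+ i)) _ ⟩
        - (+ i * + suc i) * t (jp+ i) ∎
        where open ModReasoning P

      -- The first step of the block has a numerator divisible by p, and the denominators (i + 1)²
      -- are units, so the factor p persists to the end of the block.
      p∣t : ∀ i → i < h ℕ.+ h → t (jp+ suc i) ≡ 0ℤ [mod P ]
      p∣t i i<2h = *-cancelˡ-mod
        (Invertible-* (1+i-invertible i<2h) (1+i-invertible i<2h))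
        (mod-trans (t-reduced i) (mod-trans (vanishes i i<2h) (≡⇒mod (sym (ℤ.*-zeroʳ (+ suc i * + suc i))))))
        where
        vanishes : ∀ i → i < h ℕ.+ h → - (+ i * + suc i) * t (jp+ i) ≡ 0ℤ [mod P ]
        vanishes zero    _    = ≡⇒mod refl
        vanishes (suc i) i<2h = mod-trans
          (mod-*ˡ (- (+ suc i * + suc (suc i))) (p∣t i (ℕ.<-trans (ℕ.n<1+n i) i<2h)))
          (≡⇒mod (ℤ.*-zeroʳ (- (+ suc i * + suc (suc i)))))

      -- With t(jp + i + 1) = d p this is d², the cofactor of p² in the squared term.
      p-part : ∀ {i} → i < h ℕ.+ h → ℤ
      p-part {i} i<2h = _≡_[mod_].quotient (p∣t i i<2h) * _≡_[mod_].quotient (p∣t i i<2h)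

      t²≡p²d : ∀ {i} (i<2h : i < h ℕ.+ h) → t² (jp+ suc i) ≡ P * P * p-part i<2h
      t²≡p²d {i} i<2h = trans (cong (λ z → z * z) (_≡_[mod_].equality (p∣t i i<2h)))
                              (lemma (_≡_[mod_].quotient (p∣t i i<2h)) P)
        where
        lemma : ∀ d P → (0ℤ + d * P) * (0ℤ + d * P) ≡ P * P * (d * d)
        lemma = solve-∀

      -- Multiples of p² only see their cofactors modulo p.
      t²-scale : ∀ {i x y} → i < h ℕ.+ h → x ≡ y [mod P ] →
                 t² (jp+ suc i) * x ≡ t² (jp+ suc i) * y [mod P³ ]
      t²-scale {i} {x} {y} i<2h x≡y = begin
        t² (jp+ suc i) * x          ≡⟨ cong (_* x) (t²≡p²d i<2h) ⟩
        P * P * p-part i<2h * x     ≈⟨ mod-scale P (p-part i<2h) x≡y ⟩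
        P * P * p-part i<2h * y     ≡⟨ cong (_* y) (t²≡p²d i<2h) ⟨
        t² (jp+ suc i) * y          ∎
        where open ModReasoning P³

      -- With k = jp + i + 1, squaring the recurrence gives (k + 1)⁴ t(k + 1)² = F² t(k)², where F ≡
      -- -R R′ and k + 1 ≡ R′ modulo p. Both squared terms carry p², so these congruences may be
      -- used modulo p³, and R′² cancels.
      r²t²-step : ∀ {i} → suc i < h ℕ.+ h →
        t² (jp+ suc (suc i)) * (+ suc (suc i) * + suc (suc i)) ≡ t² (jp+ suc i) * (+ suc i * + suc i) [mod P³ ]
      r²t²-step {i} 1+i<2h = *-cancelˡ-mod
        (Invertible-cube (Invertible-* (1+i-invertible 1+i<2h) (1+i-invertible 1+i<2h))) (begin
          R′ * R′ * (q′ * (R′ * R′))        ≡⟨ lemma₁ q′ R′ ⟩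
          q′ * ((R′ * R′) * (R′ * R′))      ≈⟨ t²-scale 1+i<2h (mod-* K²≡R′² K²≡R′²) ⟨
          q′ * ((K * K) * (K * K))          ≡⟨ lemma₂ (t (jp+ suc (suc i))) K ⟩
          (t (jp+ suc (suc i)) * (K * K)) * (t (jp+ suc (suc i)) * (K * K))
            ≡⟨ cong (λ k → (t k * (K * K)) * (t k * (K * K))) (ℕ.+-suc (j ℕ.* p) (suc i)) ⟩
          (t (suc (jp+ suc i)) * (K * K)) * (t (suc (jp+ suc i)) * (K * K))
            ≡⟨ cong (λ z → z * z) (t-recurrence (jp+ suc i)) ⟩
          (t (jp+ suc i) * F) * (t (jp+ suc i) * F) ≡⟨ lemma₃ (t (jp+ suc i)) F ⟩
          q * (F * F)                       ≈⟨ t²-scale i<2h (mod-* (numerator≡ (suc i)) (numerator≡ (suc i))) ⟩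
          q * (- (R * R′) * - (R * R′))     ≡⟨ lemma₄ q R R′ ⟩
          R′ * R′ * (q * (R * R))           ∎)
        where
        open ModReasoning P³
        i<2h : i < h ℕ.+ h
        i<2h = ℕ.<-trans (ℕ.n<1+n i) 1+i<2h
        R = + suc i
        R′ = + suc (suc i)
        q = t² (jp+ suc i)
        q′ = t² (jp+ suc (suc i))
        K = 1ℤ + + (jp+ suc i)
        F = (P * N - + (jp+ suc i)) * (P * N + (1ℤ + + (jp+ suc i)))
        K²≡R′² : K * K ≡ R′ * R′ [mod P ]
        K²≡R′² = mod-* (1+[jp+i]≡1+i (suc i)) (1+[jp+i]≡1+i (suc i))
        lemma₁ : ∀ q r → r * r * (q * (r * r)) ≡ q * ((r * r) * (r * r))
        lemma₁ = solve-∀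
        lemma₂ : ∀ t K → (t * t) * ((K * K) * (K * K)) ≡ (t * (K * K)) * (t * (K * K))
        lemma₂ = solve-∀
        lemma₃ : ∀ t F → (t * F) * (t * F) ≡ (t * t) * (F * F)
        lemma₃ = solve-∀
        lemma₄ : ∀ q r s → q * (- (r * s) * - (r * s)) ≡ s * s * (q * (r * r))
        lemma₄ = solve-∀

      r²t²-const : ∀ i → i < h ℕ.+ h → t² (jp+ suc i) * (+ suc i * + suc i) ≡ t² (jp+ 1) [mod P³ ]
      r²t²-const zero    _    = ≡⇒mod (ℤ.*-identityʳ (t² (jp+ 1)))
      r²t²-const (suc i) i<2h = mod-trans (r²t²-step i<2h) (r²t²-const i (ℕ.<-trans (ℕ.n<1+n i) i<2h))

      t²≡cr⁻² : ∀ i → i < h ℕ.+ h → t² (jp+ suc i) ≡ t² (jp+ 1) * r⁻² (suc i) [mod P³ ]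
      t²≡cr⁻² i i<2h = begin
        q                       ≡⟨ ℤ.*-identityʳ q ⟨
        -- Inserting r² r⁻² for 1 is legitimate because q is a multiple of p².
        q * 1ℤ                  ≈⟨ t²-scale i<2h (r²r⁻²≡1 z<s (i<2h⇒1+i<p i<2h)) ⟨
        q * (R * R * g)         ≡⟨ ℤ.*-assoc q (R * R) g ⟨
        q * (R * R) * g         ≈⟨ mod-*ʳ g (r²t²-const i i<2h) ⟩
        t² (jp+ 1) * g          ∎
        where
        open ModReasoning P³
        q = t² (jp+ suc i)
        R = + suc i
        g = r⁻² (suc i)

      ∑t²≡0 : ∑ (λ i → t² (jp+ suc i)) (h ℕ.+ h) ≡ 0ℤ [mod P³ ]
      ∑t²≡0 = begin
        ∑ (λ i → t² (jp+ suc i)) (h ℕ.+ h)              ≈⟨ ∑-mod (h ℕ.+ h) t²≡cr⁻² ⟩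
        ∑ (λ i → t² (jp+ 1) * r⁻² (suc i)) (h ℕ.+ h)    ≡⟨ *-distribˡ-∑ (t² (jp+ 1)) (λ i → r⁻² (suc i)) (h ℕ.+ h) ⟨
        -- `t² (jp+ 1)` supplies p², and the full sum of inverse squares the third factor p.
        t² (jp+ 1) * S (h ℕ.+ h)                        ≈⟨ t²-scale 0<2h S[2h]≡0 ⟩
        t² (jp+ 1) * 0ℤ                                 ≡⟨ ℤ.*-zeroʳ (t² (jp+ 1)) ⟩
        0ℤ                                              ∎
        where
        open ModReasoning P³
        0<2h : 0 < h ℕ.+ h
        0<2h = ℕ.≤-pred (ℕ.<-trans (s≤s z<s) (subst (3 <_) p≡1+2h p>3))

    -- Block by block: index jp contributes u(j)², and the other p - 1 indices contribute 0 in
    -- total.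
    ∑t²≡∑u² : ∀ L → ∑ t² (L ℕ.* p) ≡ ∑ u² L [mod P³ ]
    ∑t²≡∑u² zero    = mod-refl
    ∑t²≡∑u² (suc L) = begin
      ∑ t² (p ℕ.+ L ℕ.* p)                              ≡⟨ cong (∑ t²) (trans (ℕ.+-comm p (L ℕ.* p)) (cong (L ℕ.* p ℕ.+_) p≡1+2h)) ⟩
      ∑ t² (L ℕ.* p ℕ.+ suc (h ℕ.+ h))                  ≡⟨ ∑-++ t² (L ℕ.* p) (suc (h ℕ.+ h)) ⟩
      ∑ t² (L ℕ.* p) + ∑ (λ i → t² (jp+ i)) (suc (h ℕ.+ h))
        ≡⟨ cong (λ z → ∑ t² (L ℕ.* p) + z) (∑-first (λ i → t² (jp+ i)) (h ℕ.+ h)) ⟩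
      ∑ t² (L ℕ.* p) + (t² (jp+ 0) + ∑ (λ i → t² (jp+ suc i)) (h ℕ.+ h))
        ≈⟨ mod-+ (∑t²≡∑u² L) (mod-+ (mod-* t≡u t≡u) ∑t²≡0) ⟩
      ∑ u² L + (u² L + 0ℤ)                              ≡⟨ cong (λ z → ∑ u² L + z) (ℤ.+-identityʳ (u² L)) ⟩
      ∑ u² L + u² L                                     ∎
      where
      open ModReasoning P³
      open Block L
      t≡u : t (jp+ 0) ≡ u L [mod P³ ]
      t≡u = mod-trans (≡⇒mod (cong t (ℕ.+-identityʳ (L ℕ.* p)))) (t[jp]≡u[j] L)

  -- Removal of the lowest digit

  apery[mp]≡apery[m] : ∀ m → + apery (m ℕ.* p) ≡ + apery m [mod P³ ]
  apery[mp]≡apery[m] m = begin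
    -- p - 1 vanishing terms extend the range 0, ..., mp to m + 1 full blocks.
    + apery n                         ≡⟨ apery≡∑-extended n (h ℕ.+ h) ⟩
    ∑ t² (suc n ℕ.+ (h ℕ.+ h))        ≡⟨ cong (∑ t²) (trans (sym (ℕ.+-suc n (h ℕ.+ h))) (trans (cong (n ℕ.+_) (sym p≡1+2h)) (ℕ.+-comm n p))) ⟩
    ∑ t² (suc m ℕ.* p)                ≈⟨ ∑t²≡∑u² (suc m) ⟩
    ∑ u² (suc m)                      ≡⟨ apery≡∑ m ⟨
    + apery m                         ∎
    where
    open ModReasoning P³
    n = m ℕ.* p
    open Supercongruence (+ m)
      (subst (λ x → IsAperySequence x (aperyRoot n)) (trans (pos-* m p) (ℤ.*-comm (+ m) P)) (aperyRoot-isAperySequence n))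
      (aperyRoot-isAperySequence m)

  -- x(x + 1) is invariant under x ↦ −1 − x, which turns n = (m + 1)p − 1 into −(m + 1)p.
  apery[p∸1+mp]≡apery[m] : ∀ m → + apery (p ∸ 1 ℕ.+ m ℕ.* p) ≡ + apery m [mod P³ ]
  apery[p∸1+mp]≡apery[m] m = begin
    + apery n                         ≡⟨ apery≡∑ n ⟩
    -- Here the range 0, ..., n already consists of m + 1 full blocks.
    ∑ t² (suc n)                      ≡⟨ cong (∑ t²) 1+n≡[1+m]p ⟩
    ∑ t² (suc m ℕ.* p)                ≈⟨ ∑t²≡∑u² (suc m) ⟩
    ∑ u² (suc m)                      ≡⟨ apery≡∑ m ⟨
    + apery m                         ∎
    where
    n = p ∸ 1 ℕ.+ m ℕ.* p
    1+n≡[1+m]p : suc n ≡ suc m ℕ.* p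
    1+n≡[1+m]p = cong (ℕ._+ m ℕ.* p) (ℕ.m+[n∸m]≡n {1} (ℕ.≤-trans (s≤s z≤n) p>3))
    index : - + suc n ≡ P * - + suc m
    index = trans (cong -_ (trans (cong +_ 1+n≡[1+m]p) (pos-* (suc m) p))) (lemma (+ suc m) P)
      where
      lemma : ∀ m P → - (m * P) ≡ P * - m
      lemma = solve-∀
    open Supercongruence (- + suc m)
      (subst (λ x → IsAperySequence x (aperyRoot n)) index (IsAperySequence-reflect (aperyRoot-isAperySequence n)))
      (IsAperySequence-reflect (aperyRoot-isAperySequence m))
    open ModReasoning P³

  apery≡1 : ∀ n → (∀ i → digit p n i ≡ 0 ⊎ digit p n i ≡ p ∸ 1) → + apery n ≡ 1ℤ [mod P³ ]
  apery≡1 = <-rec _ step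
    where
    Digits = λ n → ∀ i → digit p n i ≡ 0 ⊎ digit p n i ≡ p ∸ 1
    step : ∀ n → (∀ {m} → m < n → Digits m → + apery m ≡ 1ℤ [mod P³ ]) →
           Digits n → + apery n ≡ 1ℤ [mod P³ ]
    -- A(0) computes to 1, which ends the descent.
    step zero      _   _      = mod-refl
    -- `digit` recurses through `n / p`, so `digits (suc i)` is literally the hypothesis on the
    -- digits of `n / p`.
    step n@(suc _) rec digits = mod-trans (strip (digits 0))
      (rec (m/n<m n p (ℕ.≤-trans (s≤s (s≤s z≤n)) p>3)) (λ i → digits (suc i)))
      where
      strip : n % p ≡ 0 ⊎ n % p ≡ p ∸ 1 → + apery n ≡ + apery (n / p) [mod P³ ]
      strip (inj₁ n%p≡0) = mod-trans
        (≡⇒mod (cong (λ k → + apery k) (trans (m≡m%n+[m/n]*n n p) (cong (ℕ._+ n / p ℕ.* p) n%p≡0))))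
        (apery[mp]≡apery[m] (n / p))
      strip (inj₂ n%p≡p∸1) = mod-trans
        (≡⇒mod (cong (λ k → + apery k) (trans (m≡m%n+[m/n]*n n p) (cong (ℕ._+ n / p ℕ.* p) n%p≡p∸1))))
        (apery[p∸1+mp]≡apery[m] (n / p))

-- Oddness of p and passage to remainders

even⊎odd : ∀ n → ∃ λ h → n ≡ h ℕ.+ h ⊎ n ≡ suc (h ℕ.+ h)
even⊎odd zero    = 0 , inj₁ refl
even⊎odd (suc n) with even⊎odd n
... | h , inj₁ refl = h , inj₂ refl
... | h , inj₂ refl = suc h , inj₁ (cong suc (sym (ℕ.+-suc h h)))

-- If p = 2h, then 2 divides p, and irreducibility leaves only p = 2.
prime>2⇒odd : ∀ {p} → Prime p → 2 < p → ∃ λ h → p ≡ suc (h ℕ.+ h)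
prime>2⇒odd {p} p-prime p>2 with even⊎odd p
... | h , inj₂ p≡1+2h = h , p≡1+2h
... | h , inj₁ p≡2h with prime⇒irreducible p-prime (divides h (trans p≡2h (lemma h)))
  where
  lemma : ∀ h → h ℕ.+ h ≡ h ℕ.* 2
  lemma = solveℕ-∀
...   | inj₂ refl = contradiction p>2 (ℕ.<-irrefl refl)

-- Remainders live in ℕ, so a nonnegative quotient is a multiple of n added to b, and a negative one
-- is moved over to a.
mod⇒% : ∀ {a b n} .{{_ : NonZero n}} → + a ≡ + b [mod + n ] → a % n ≡ b % n
mod⇒% {a} {b} {n} (mod (+ k) eq) = trans (cong (_% n) (ℤ.+-injective (trans eq (cong (λ z → + b + z) (sym (pos-* k n))))))
                                 ([m+kn]%n≡m%n b k n)
mod⇒% {a} {b} {n} (mod -[1+ k ] eq) = trans (sym ([m+kn]%n≡m%n a (suc k) n)) (cong (_% n) (ℤ.+-injective (begin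
  + a + + (suc k ℕ.* n)                  ≡⟨ cong₂ _+_ eq (pos-* (suc k) n) ⟩
  + b + -[1+ k ] * + n + + suc k * + n   ≡⟨ lemma (+ b) (+ suc k) (+ n) ⟩
  + b                                    ∎)))
  where
  open ≡-Reasoning
  lemma : ∀ b k n → b + - k * n + k * n ≡ b
  lemma = solve-∀

theorem9 : (p : ℕ) .{{_ : NonZero p}} → Prime p → p ≥ 5 → (n : ℕ)
    → (∀ i → digit p n i ≡ 0 ⊎ digit p n i ≡ p ∸ 1)
    → _%_ (apery n) (p ^ 3) {{m^n≢0 p 3}} ≡ _%_ 1 (p ^ 3) {{m^n≢0 p 3}}
theorem9 p p-prime p≥5 n digits with prime>2⇒odd p-prime (ℕ.≤-trans (s≤s (s≤s (s≤s z≤n))) p≥5)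
... | h , p≡1+2h =
  mod⇒% {{m^n≢0 p 3}} (subst (λ m → + apery n ≡ 1ℤ [mod m ]) P³≡
    (apery≡1 n digits))
  where
  p>3 = ℕ.≤-trans (s≤s (s≤s (s≤s (s≤s z≤n)))) p≥5
  open OddPrime p h p-prime p>3 p≡1+2h
  P³≡ : cube (+ p) ≡ + (p ^ 3)
  -- `p ^ 3` unfolds to p · (p · (p · 1)), so only the final factor 1 has to be removed.
  P³≡ = sym (trans (pos-* p (p ^ 2)) (cong (+ p *_) (trans (pos-* p (p ^ 1)) (cong (λ k → + p * + k) (ℕ.*-identityʳ p)))))
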